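{- Let $F$ be a graph, let $r\ge 2$ be an integer, and let $\mathcal{H}$ be an $r$-uniform Berge-$F$-free hypergraph. Then there exists an $F$-free red-blue graph $G$ on the vertex set of $\mathcal{H}$ such that \[|\mathcal{H}| \leq g_r(G) = e(G_{\mathrm{red}}) + \mathcal{N}(K_r,G_{\mathrm{blue}}),\] where $|\mathcal{H}|$ denotes the number of hyperedges of $\mathcal{H}$.
   Context: All graphs and hypergraphs are finite and simple (no repeated edges or hyperedges). A hypergraph $\mathcal{H}$ contains a Berge-$F$ (Berge copy of the graph $F$) if there are an injection $\varphi:V(F)\to V(\mathcal{H})$ and an injection $f:E(F)\to E(\mathcal{H})$ with $\{\varphi(u),\varphi(v)\}\subset f(uv)$ for every edge $uv\in E(F)$; otherwise $\mathcal{H}$ is Berge-$F$-free. A graph is $F$-free if it has no (not necessarily induced) subgraph isomorphic to $F$. A red-blue graph is a graph $G$ each of whose edges is colored red or blue; it is $F$-free if its underlying uncolored graph is $F$-free. $G_{\mathrm{red}}$ and $G_{\mathrm{blue}}$ denote the graphs formed by the red and by the blue edges, $e(\cdot)$ is the number of edges, and $\mathcal{N}(K_r,G_{\mathrm{blue}})$ is the number of copies of $K_r$ in $G_{\mathrm{blue}}$. Put $g_r(G)=e(G_{\mathrm{red}})+\mathcal{N}(K_r,G_{\mathrm{blue}})$. -}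

module Defs where

open import Data.Bool.Properties as Bool using ()
open import Data.Fin.Base using (Fin)
open import Data.Fin.Properties as Fin using (all?)
open import Data.Fin.Subset using (Subset; inside; outside; ⁅_⁆; _∪_; _∈_; _⊆_; ∣_∣)
open import Data.Fin.Subset.Properties using (_∈?_)
open import Data.List.Base using (List; []; [_]; _∷_; _++_; map; filter; length; lookup)
open import Data.List.Membership.Propositional using () renaming (_∈_ to _∈ˡ_)
open import Data.List.Membership.DecPropositional using () renaming (_∈?_ to ∈ˡ-dec)
open import Data.List.Relation.Unary.All using (All)
open import Data.List.Relation.Unary.All.Properties as All using ()
open import Data.List.Relation.Unary.Unique.Propositional using (Unique)
open import Data.List.Relation.Unary.Unique.Propositional.Properties as Unique using ()
open import Data.Nat.Base using (ℕ; zero; suc; _+_)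
open import Data.Nat.Properties as ℕ using ()
open import Data.Product.Base using (_×_; Σ-syntax)
open import Data.Vec.Base using ([]; _∷_)
open import Data.Vec.Properties using (≡-dec)
open import Function.Bundles using (_↣_; module Injection)
open import Relation.Binary.Definitions using (DecidableEquality)
open import Relation.Binary.PropositionalEquality using (_≡_; _≢_; refl)
open import Relation.Nullary.Decidable using (Dec; yes; no; ¬?; _×-dec_; _→-dec_)
open import Relation.Nullary.Negation using (¬_)

_≟ˢ_ : ∀ {n} → DecidableEquality (Subset n)
_≟ˢ_ = ≡-dec Bool._≟_

⁅_,_⁆ : ∀ {n} → Fin n → Fin n → Subset n
⁅ u , v ⁆ = ⁅ u ⁆ ∪ ⁅ v ⁆

record Hypergraph (n : ℕ) : Set where
  field
    edges  : List (Subset n)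
    unique : Unique edges

  size : ℕ
  size = length edges

  -- Edges are referred to by their position in the list; as the list has no
  -- repetitions, distinct positions carry distinct edges.
  Edge : Set
  Edge = Fin size

  edge : Edge → Subset n
  edge = lookup edges

open Hypergraph public

Uniform : ∀ {n} → ℕ → Hypergraph n → Set
Uniform r H = All (λ e → ∣ e ∣ ≡ r) (edges H)

record Graph (n : ℕ) : Set where
  field
    hypergraph : Hypergraph n
    uniform    : Uniform 2 hypergraph

open Graph public

E : ∀ {n} → Graph n → Set
E G = Edge (hypergraph G)

ends : ∀ {n} (G : Graph n) → E G → Subset n
ends G = edge (hypergraph G)

e : ∀ {n} → Graph n → ℕ
e G = size (hypergraph G)

-- There are no loops: ⁅ u , u ⁆ has one element, so it is not an edge.
Adj : ∀ {n} → Graph n → Fin n → Fin n → Set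
Adj G u v = ⁅ u , v ⁆ ∈ˡ edges (hypergraph G)

adj? : ∀ {n} (G : Graph n) u v → Dec (Adj G u v)
adj? G u v = ∈ˡ-dec _≟ˢ_ ⁅ u , v ⁆ (edges (hypergraph G))

Contains : ∀ {k n} → Graph k → Graph n → Set
Contains {k} {n} F G =
  Σ[ φ ∈ Fin k ↣ Fin n ] (∀ u v → Adj F u v → Adj G (Injection.to φ u) (Injection.to φ v))

Free : ∀ {k n} → Graph k → Graph n → Set
Free F G = ¬ Contains F G

ContainsBerge : ∀ {k n} → Graph k → Hypergraph n → Set
ContainsBerge {k} {n} F H =
  Σ[ φ ∈ Fin k ↣ Fin n ] Σ[ f ∈ E F ↣ Edge H ]
    (∀ uv u v → ends F uv ≡ ⁅ u , v ⁆ →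
      ⁅ Injection.to φ u , Injection.to φ v ⁆ ⊆ edge H (Injection.to f uv))

BergeFree : ∀ {k n} → Graph k → Hypergraph n → Set
BergeFree F H = ¬ ContainsBerge F H

subsets : ∀ n → List (Subset n)
subsets zero    = [ [] ]
subsets (suc n) = map (outside ∷_) (subsets n) ++ map (inside ∷_) (subsets n)

IsClique : ∀ {n} → Graph n → Subset n → Set
IsClique G S = ∀ u v → u ∈ S → v ∈ S → u ≢ v → Adj G u v

isClique? : ∀ {n} (G : Graph n) S → Dec (IsClique G S)
isClique? G S = all? λ u → all? λ v →
  (u ∈? S) →-dec ((v ∈? S) →-dec (¬? (u Fin.≟ v) →-dec adj? G u v))

-- A copy of K_r, as a subgraph, is determined by its vertex set: r vertices that
-- are pairwise adjacent.
𝒩K : ∀ {n} → ℕ → Graph n → ℕ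
𝒩K {n} r G = length (filter (λ S → (∣ S ∣ ℕ.≟ r) ×-dec isClique? G S) (subsets n))

data Colour : Set where
  red blue : Colour

_≟ᶜ_ : DecidableEquality Colour
red  ≟ᶜ red  = yes refl
red  ≟ᶜ blue = no λ ()
blue ≟ᶜ red  = no λ ()
blue ≟ᶜ blue = yes refl

-- Only the values of colour on the edges of the graph are ever used.
record RedBlueGraph (n : ℕ) : Set where
  field
    graph  : Graph n
    colour : Subset n → Colour

  coloured : Colour → Graph n
  coloured c = record
    { hypergraph = record
      { edges  = filter (λ uv → colour uv ≟ᶜ c) (edges (hypergraph graph))
      ; unique = Unique.filter⁺ (λ uv → colour uv ≟ᶜ c) (unique (hypergraph graph))
      }
    ; uniform = All.filter⁺ (λ uv → colour uv ≟ᶜ c) (uniform graph)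
    }

open RedBlueGraph public

g : ∀ {n} → ℕ → RedBlueGraph n → ℕ
g r G = e (coloured G red) + 𝒩K r (coloured G blue)

{-# OPTIONS --safe #-}
-- Match hyperedges injectively with vertex pairs they contain, using a maximum
-- matching, and let X be the set of hyperedges reachable by alternating walks from
-- the unmatched ones. The edges of G are the matched pairs, so a copy of F in G is a
-- Berge-F in the hypergraph; a pair is blue when it lies in a hyperedge of X. By
-- maximality every pair inside a hyperedge of X is matched, hence that hyperedge
-- spans a blue clique; a hyperedge outside X is matched, and its pair is red because
-- otherwise the hyperedge would be reachable.
module Submission where

open import Defs
open import Data.Fin.Base using (Fin; zero; suc; join; splitAt)
open import Data.Fin.Properties as Fin using (any?; splitAt-join; injective⇒≤)
open import Data.Fin.Subset using (Subset; inside; outside; ⊥; _∪_; _∈_; _∉_; _⊆_; _⊃_; ∣_∣)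
  renaming (⁅_⁆ to ⁅_⁆₁)
open import Data.Fin.Subset.Induction using (⊃-wellFounded)
open import Data.Fin.Subset.Properties
  using (_∈?_; _⊆?_; ∉⊥; x∈⁅x⁆; x∈⁅y⁆⇒x≡y; x∈p∪q⁺; x∈p∪q⁻; p⊆p∪q; ⊆-antisym;
         ∪-identityˡ; ∪-identityʳ; ∣⁅x⁆∣≡1)
open import Data.List.Base using (List; []; _∷_; map; filter; lookup)
open import Data.List.Membership.Propositional using () renaming (_∈_ to _∈ˡ_)
open import Data.List.Membership.DecPropositional using () renaming (_∈?_ to ∈ˡ-dec)
open import Data.List.Membership.Propositional.Properties
  using (∈-filter⁺; ∈-filter⁻; ∈-lookup; ∈-map⁺; ∈-map⁻; ∈-++⁺ˡ; ∈-++⁺ʳ)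
import Data.List.Relation.Unary.All as All
import Data.List.Relation.Unary.AllPairs as AllPairs
open import Data.List.Relation.Unary.Any as Any using (index)
open import Data.List.Relation.Unary.Any.Properties using (lookup-index)
open import Data.List.Relation.Unary.Unique.Propositional using (Unique)
import Data.List.Relation.Unary.Unique.Propositional.Properties as Unique
open import Data.Maybe.Base using (Maybe; just; nothing)
open import Data.Maybe.Properties using (just-injective; ≡-dec)
open import Data.Nat.Base using (ℕ; zero; suc; _≤_)
open import Data.Nat.Properties as ℕ using (suc-injective)
open import Data.Product.Base using (_×_; Σ-syntax; ∃; ∃₂; _,_; proj₁; proj₂)
open import Data.Sum.Base using (_⊎_; inj₁; inj₂; [_,_])
open import Data.Sum.Properties using (inj₁-injective; inj₂-injective)
open import Data.Unit.Base using (⊤; tt)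
open import Data.Vec.Base using ([]; _∷_)
open import Data.Vec.Properties using (∷-injectiveʳ)
open import Data.Vec.Functional using (updateAt)
open import Data.Vec.Functional.Properties using (updateAt-updates; updateAt-minimal)
open import Function.Base using (_∘_; const)
open import Function.Bundles using (_↣_; mk↣; module Injection)
open import Function.Definitions using (Injective)
open import Induction.WellFounded using (Acc; acc)
open import Relation.Binary.Definitions using (DecidableEquality)
open import Relation.Binary.PropositionalEquality
  using (_≡_; _≢_; refl; sym; trans; cong; subst)
open import Relation.Nullary.Decidable using (Dec; yes; no; ¬?; _×-dec_)
open import Relation.Nullary.Negation using (¬_; contradiction)

-- Each round that does not yield `Q` adds a new element, so the rounds stop because `_⊃_` on
-- `Subset m` is well-founded. Both the set reached by alternating walks and the maximum matching
-- are built by this loop.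
saturate : ∀ {m} {P : Subset m → Set} {Q : Set} →
           (∀ s → P s → Q ⊎ Σ[ x ∈ Fin m ] (x ∉ s × P (s ∪ ⁅ x ⁆₁))) → P ⊥ → Q
saturate {m} {P} {Q} step = go ⊥ (⊃-wellFounded ⊥)
  where
  go : ∀ s → Acc _⊃_ s → P s → Q
  go s (acc rs) p with step s p
  ... | inj₁ q = q
  ... | inj₂ (x , x∉s , p′) =
    go _ (rs (p⊆p∪q ⁅ x ⁆₁ , x , x∈p∪q⁺ (inj₂ (x∈⁅x⁆ x)) , x∉s)) p′

-- Bipartite matchings and König's theorem

module Matchings {B : Set} (_≟_ : DecidableEquality B) {m : ℕ} (N : Fin m → List B) where

  _[_≔_] : (Fin m → Maybe B) → Fin m → B → Fin m → Maybe B
  M [ h ≔ b ] = updateAt M h (const (just b))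

  record Matching : Set where
    field
      match     : Fin m → Maybe B
      valid     : ∀ {a b} → match a ≡ just b → b ∈ˡ N a
      injective : ∀ {a a′ b} → match a ≡ just b → match a′ ≡ just b → a ≡ a′

  open Matching public

  Matched Unmatched : Matching → Fin m → Set
  Matched   μ a = ∃ λ b → match μ a ≡ just b
  Unmatched μ a = match μ a ≡ nothing

  Uses : Matching → B → Set
  Uses μ b = ∃ λ a → match μ a ≡ just b

  uses? : ∀ μ b → Dec (Uses μ b)
  uses? μ b = any? λ a → ≡-dec _≟_ (match μ a) (just b)

  -- `h` may already have a partner, which is then released; flipping a walk relies on this.
  -- Injectivity survives because no element holds `b`.
  rematch : ∀ μ {h b} → b ∈ˡ N h → ¬ Uses μ b → Matching
  rematch μ {h} {b} b∈Nh free = record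
    { match = M ; valid = λ {a} → val a ; injective = λ {a} {a′} → inj a a′ }
    where
    M = match μ [ h ≔ b ]

    val : ∀ a {b′} → M a ≡ just b′ → b′ ∈ˡ N a
    val a eq with a Fin.≟ h
    ... | yes refl = subst (_∈ˡ N h)
                       (just-injective (trans (sym (updateAt-updates h (match μ))) eq)) b∈Nh
    ... | no a≢h = valid μ (trans (sym (updateAt-minimal a h (match μ) a≢h)) eq)

    clash : ∀ {a b′} → a ≢ h → M h ≡ just b′ → M a ≢ just b′
    clash {a} a≢h eqh eqa = free (a ,
      trans (sym (updateAt-minimal a h (match μ) a≢h))
        (trans eqa (trans (sym eqh) (updateAt-updates h (match μ)))))

    inj : ∀ a a′ {b′} → M a ≡ just b′ → M a′ ≡ just b′ → a ≡ a′
    inj a a′ eq eq′ with a Fin.≟ h | a′ Fin.≟ h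
    ... | yes refl | yes refl = refl
    ... | yes refl | no a′≢h  = contradiction eq′ (clash a′≢h eq)
    ... | no a≢h   | yes refl = contradiction eq (clash a≢h eq′)
    ... | no a≢h   | no a′≢h  = injective μ
      (trans (sym (updateAt-minimal a h (match μ) a≢h)) eq)
      (trans (sym (updateAt-minimal a′ h (match μ) a′≢h)) eq′)

  rematch-matched : ∀ μ {h b} (b∈Nh : b ∈ˡ N h) (free : ¬ Uses μ b) →
                    Matched (rematch μ b∈Nh free) h
  rematch-matched μ {h} _ _ = _ , updateAt-updates h (match μ)

  rematch-preserves : ∀ μ {h b} (b∈Nh : b ∈ˡ N h) (free : ¬ Uses μ b) {a} →
                      Matched μ a → Matched (rematch μ b∈Nh free) a
  rematch-preserves μ {h} b∈Nh free {a} (b′ , eq) with a Fin.≟ h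
  ... | yes refl = rematch-matched μ b∈Nh free
  ... | no a≢h   = b′ , trans (updateAt-minimal a h (match μ) a≢h) eq

  -- Walk M n h: an alternating walk with at most n steps leads from an unmatched
  -- element to h. It may revisit elements.
  data Walk (M : Fin m → Maybe B) : ℕ → Fin m → Set where
    start : ∀ {n h} → M h ≡ nothing → Walk M n h
    step  : ∀ {n h h′ b} → Walk M n h′ → b ∈ˡ N h′ → M h ≡ just b → Walk M (suc n) h

  weaken : ∀ {M n h} → Walk M n h → Walk M (suc n) h
  weaken (start eq)    = start eq
  weaken (step w b eq) = step (weaken w) b eq

  -- Either the walk passes through h, and is cut there, or it survives rematching h.
  reroute : ∀ {M n h′} h b → Walk M n h′ → Walk M n h ⊎ Walk (M [ h ≔ b ]) n h′
  reroute {M} {h′ = h′} h b (start eq) with h′ Fin.≟ h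
  ... | yes refl = inj₁ (start eq)
  ... | no h′≢h  = inj₂ (start (trans (updateAt-minimal h′ h M h′≢h) eq))
  reroute {M} {h′ = h′} h b (step w b∈N eq) with h′ Fin.≟ h | reroute h b w
  ... | yes refl | _       = inj₁ (step w b∈N eq)
  ... | no _     | inj₁ w′ = inj₁ (weaken w′)
  ... | no h′≢h  | inj₂ w′ = inj₂ (step w′ b∈N (trans (updateAt-minimal h′ h M h′≢h) eq))

  -- Partners may change, but matched elements stay matched, so the matched set grows strictly and
  -- the number of augmentations is bounded.
  Augmentation : Matching → Set
  Augmentation μ = Σ[ μ′ ∈ Matching ] (∀ {a} → Matched μ a → Matched μ′ a) ×
                   ∃ λ h → Unmatched μ h × Matched μ′ h

  -- The walk is flipped from its free end: giving the free b to h releases the old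
  -- partner of h to the previous element of the walk.
  augment : ∀ μ n {h b} → Walk (match μ) n h → b ∈ˡ N h → ¬ Uses μ b → Augmentation μ
  augment μ n {h} (start eq) b∈Nh free =
    rematch μ b∈Nh free , rematch-preserves μ b∈Nh free , h , eq , rematch-matched μ b∈Nh free
  augment μ (suc n) {h} {b} (step {b = c} w c∈N eq) b∈Nh free with reroute h b w
  -- The walk to the previous element already passes through `h`, so its cut ends at `h` and the
  -- same free `b` serves. The recursion is on the bound `n`, since a rerouted walk is no subterm of
  -- the given one.
  ... | inj₁ w′ = augment μ n w′ b∈Nh free
  ... | inj₂ w′ with augment μ₁ n w′ c∈N released
    where
    μ₁ = rematch μ b∈Nh free

    -- Only `h` held `c`, and now it holds `b`, which differs from `c` because `b` was free.
    released : ¬ Uses μ₁ c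
    released (a , eq′) with a Fin.≟ h
    ... | yes refl = free (h , trans eq (trans (sym eq′) (updateAt-updates h (match μ))))
    ... | no a≢h   = a≢h (injective μ (trans (sym (updateAt-minimal a h (match μ) a≢h)) eq′) eq)
  ... | μ′ , keeps , x , x∉ , x∈ =
    μ′ , keeps ∘ rematch-preserves μ b∈Nh free , x , unmatched , x∈
    where
    unmatched : Unmatched μ x
    unmatched with x Fin.≟ h
    ... | yes refl = contradiction (trans (sym x∉) (updateAt-updates h (match μ))) λ ()
    ... | no x≢h   = trans (sym (updateAt-minimal x h (match μ) x≢h)) x∉

  Reached : Subset m → B → Set
  Reached X b = ∃ λ h → h ∈ X × b ∈ˡ N h

  reached? : ∀ X b → Dec (Reached X b)
  reached? X b = any? λ h → (h ∈? X) ×-dec ∈ˡ-dec _≟_ b (N h)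

  -- The test for adding an element with partner `v` to `X`: an unmatched element starts a walk, and
  -- one whose partner is reached from `X` extends a walk by one step.
  Enters : Subset m → Maybe B → Set
  Enters X nothing  = ⊤
  Enters X (just b) = Reached X b

  enters? : ∀ X v → Dec (Enters X v)
  enters? X nothing  = yes tt
  enters? X (just b) = reached? X b

  Closed : Matching → Subset m → Set
  Closed μ X = ∀ h → h ∉ X → ∃ λ b → match μ h ≡ just b × ¬ Reached X b

  Walkable : Matching → Subset m → Set
  Walkable μ X = ∀ {h} → h ∈ X → ∃ λ n → Walk (match μ) n h

  closure : ∀ μ → Σ[ X ∈ Subset m ] (Walkable μ X × Closed μ X)
  closure μ = saturate grow λ h∈⊥ → contradiction h∈⊥ ∉⊥
    where
    walk : ∀ {X h} → Walkable μ X → Enters X (match μ h) → ∃ λ n → Walk (match μ) n h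
    walk {h = h} p e with match μ h in eq
    walk p _                 | nothing = 0 , start eq
    walk p (h′ , h′∈X , b∈N) | just b with n , w ← p h′∈X = suc n , step w b∈N eq

    closed : ∀ {X} → ¬ (∃ λ h → h ∉ X × Enters X (match μ h)) → Closed μ X
    closed none h h∉X with match μ h in eq
    ... | nothing = contradiction (h , h∉X , subst (Enters _) (sym eq) tt) none
    ... | just b  = b , refl , λ r → none (h , h∉X , subst (Enters _) (sym eq) r)

    grow : ∀ X → Walkable μ X → Σ[ X ∈ Subset m ] (Walkable μ X × Closed μ X) ⊎
                       Σ[ x ∈ Fin m ] (x ∉ X × Walkable μ (X ∪ ⁅ x ⁆₁))
    grow X p with any? (λ h → ¬? (h ∈? X) ×-dec enters? X (match μ h))
    ... | no none             = inj₁ (X , p , closed none)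
    ... | yes (x , x∉X , ent) = inj₂ (x , x∉X , λ h∈ → [ p , new ] (x∈p∪q⁻ X ⁅ x ⁆₁ h∈))
      where
      new : ∀ {h} → h ∈ ⁅ x ⁆₁ → ∃ λ n → Walk (match μ) n h
      new h∈ with refl ← x∈⁅y⁆⇒x≡y x h∈ = walk p ent

  -- A form of König's theorem: the elements outside `core` and those `Reached` from it form a
  -- vertex cover, each of them lies on a matching edge, and by `closed` no matching edge contains
  -- two of them.
  record König : Set where
    field
      matching : Matching
      core     : Subset m
      covers   : ∀ {b} → Reached core b → Uses matching b
      closed   : Closed matching core

  könig : König
  könig = saturate improve (record
    { match = const nothing ; valid = λ () ; injective = λ () } , λ h∈⊥ → contradiction h∈⊥ ∉⊥)
    where
    P : Subset m → Set
    P s = Σ[ μ ∈ Matching ] (∀ {a} → a ∈ s → Matched μ a)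

    improve : ∀ s → P s → König ⊎ Σ[ x ∈ Fin m ] (x ∉ s × P (s ∪ ⁅ x ⁆₁))
    improve s (μ , s-matched) with closure μ
    ... | X , walks , X-closed
      with any? (λ h → (h ∈? X) ×-dec Any.any? (λ b → ¬? (uses? μ b)) (N h))
    ... | no none = inj₁ (record
      { matching = μ ; core = X ; closed = X-closed ; covers = cov })
      where
      cov : ∀ {b} → Reached X b → Uses μ b
      cov {b} (h , h∈X , b∈N) with uses? μ b
      ... | yes u = u
      ... | no ¬u = contradiction (h , h∈X , Any.map (λ { refl → ¬u }) b∈N) none
    ... | yes (h , h∈X , anyFree) with n , w ← walks h∈X
      with augment μ n w (∈-lookup (index anyFree)) (lookup-index anyFree)
    ... | μ′ , keeps , x , x-unmatched , x-matched = inj₂ (x , x∉s , μ′ , matched)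
      where
      x∉s : x ∉ s
      x∉s x∈s = contradiction (trans (sym x-unmatched) (proj₂ (s-matched x∈s))) λ ()

      matched : ∀ {a} → a ∈ s ∪ ⁅ x ⁆₁ → Matched μ′ a
      matched a∈ with x∈p∪q⁻ s ⁅ x ⁆₁ a∈
      ... | inj₁ a∈s = keeps (s-matched a∈s)
      ... | inj₂ a∈x with refl ← x∈⁅y⁆⇒x≡y x a∈x = x-matched

-- Enumeration of subsets and positions in lists

subsets-complete : ∀ {n} (S : Subset n) → S ∈ˡ subsets n
subsets-complete []            = Any.here refl
subsets-complete (outside ∷ S) = ∈-++⁺ˡ (∈-map⁺ (outside ∷_) (subsets-complete S))
subsets-complete (inside  ∷ S) = ∈-++⁺ʳ _ (∈-map⁺ (inside ∷_) (subsets-complete S))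

subsets-unique : ∀ n → Unique (subsets n)
subsets-unique zero    = All.[] AllPairs.∷ AllPairs.[]
subsets-unique (suc n) = Unique.++⁺
  (Unique.map⁺ ∷-injectiveʳ (subsets-unique n)) (Unique.map⁺ ∷-injectiveʳ (subsets-unique n))
  λ (∈out , ∈in) → disjoint (∈-map⁻ (outside ∷_) ∈out) (∈-map⁻ (inside ∷_) ∈in)
  where
  disjoint : ∀ {v} → (∃ λ S → S ∈ˡ subsets n × v ≡ outside ∷ S) →
             ¬ (∃ λ S → S ∈ˡ subsets n × v ≡ inside ∷ S)
  disjoint (_ , _ , refl) (_ , _ , ())

lookup-injective : ∀ {A : Set} {xs : List A} → Unique xs → Injective _≡_ _≡_ (lookup xs)
lookup-injective (_ AllPairs.∷ _) {zero} {zero} _ = refl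
lookup-injective (x∉ AllPairs.∷ _) {zero} {suc j} eq =
  contradiction eq (All.lookup x∉ (∈-lookup j))
lookup-injective (x∉ AllPairs.∷ _) {suc i} {zero} eq =
  contradiction (sym eq) (All.lookup x∉ (∈-lookup i))
lookup-injective (_ AllPairs.∷ u) {suc i} {suc j} eq = cong suc (lookup-injective u eq)

index-injective : ∀ {A : Set} {xs : List A} {x y} (x∈ : x ∈ˡ xs) (y∈ : y ∈ˡ xs) →
                  index x∈ ≡ index y∈ → x ≡ y
index-injective {xs = xs} x∈ y∈ eq =
  trans (lookup-index x∈) (trans (cong (lookup xs) eq) (sym (lookup-index y∈)))

-- Two-element sets and their images

module _ {n} {u v : Fin n} where

  x∈⁅x,y⁆ : u ∈ ⁅ u , v ⁆
  x∈⁅x,y⁆ = x∈p∪q⁺ (inj₁ (x∈⁅x⁆ u))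

  y∈⁅x,y⁆ : v ∈ ⁅ u , v ⁆
  y∈⁅x,y⁆ = x∈p∪q⁺ (inj₂ (x∈⁅x⁆ v))

  ∈⁅,⁆⁻ : ∀ {w} → w ∈ ⁅ u , v ⁆ → w ≡ u ⊎ w ≡ v
  ∈⁅,⁆⁻ w∈ with x∈p∪q⁻ ⁅ u ⁆₁ ⁅ v ⁆₁ w∈
  ... | inj₁ w∈u = inj₁ (x∈⁅y⁆⇒x≡y u w∈u)
  ... | inj₂ w∈v = inj₂ (x∈⁅y⁆⇒x≡y v w∈v)

  ⁅,⁆⊆ : ∀ {S} → u ∈ S → v ∈ S → ⁅ u , v ⁆ ⊆ S
  ⁅,⁆⊆ u∈S v∈S w∈ with ∈⁅,⁆⁻ w∈
  ... | inj₁ refl = u∈S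
  ... | inj₂ refl = v∈S

∣⁅x,y⁆∣≡2 : ∀ {n} {u v : Fin n} → u ≢ v → ∣ ⁅ u , v ⁆ ∣ ≡ 2
∣⁅x,y⁆∣≡2 {u = zero}  {zero}  u≢v = contradiction refl u≢v
∣⁅x,y⁆∣≡2 {u = zero}  {suc v} _ =
  cong suc (trans (cong ∣_∣ (∪-identityˡ ⁅ v ⁆₁)) (∣⁅x⁆∣≡1 v))
∣⁅x,y⁆∣≡2 {u = suc u} {zero}  _ =
  cong suc (trans (cong ∣_∣ (∪-identityʳ ⁅ u ⁆₁)) (∣⁅x⁆∣≡1 u))
∣⁅x,y⁆∣≡2 {u = suc u} {suc v} u≢v = ∣⁅x,y⁆∣≡2 (u≢v ∘ cong suc)

∣S∣≡0⇒S≡⊥ : ∀ {n} {S : Subset n} → ∣ S ∣ ≡ 0 → S ≡ ⊥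
∣S∣≡0⇒S≡⊥ {S = []}          _  = refl
∣S∣≡0⇒S≡⊥ {S = outside ∷ S} eq = cong (outside ∷_) (∣S∣≡0⇒S≡⊥ eq)

∣S∣≡1⇒S≡⁅x⁆ : ∀ {n} {S : Subset n} → ∣ S ∣ ≡ 1 → ∃ λ u → S ≡ ⁅ u ⁆₁
∣S∣≡1⇒S≡⁅x⁆ {S = outside ∷ S} eq with u , refl ← ∣S∣≡1⇒S≡⁅x⁆ {S = S} eq = suc u , refl
∣S∣≡1⇒S≡⁅x⁆ {S = inside ∷ S} eq =
  zero , cong (inside ∷_) (∣S∣≡0⇒S≡⊥ (suc-injective eq))

∣S∣≡2⇒S≡⁅x,y⁆ : ∀ {n} {S : Subset n} → ∣ S ∣ ≡ 2 → ∃₂ λ u v → S ≡ ⁅ u , v ⁆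
∣S∣≡2⇒S≡⁅x,y⁆ {S = outside ∷ S} eq
  with u , v , refl ← ∣S∣≡2⇒S≡⁅x,y⁆ {S = S} eq = suc u , suc v , refl
∣S∣≡2⇒S≡⁅x,y⁆ {S = inside ∷ S} eq
  with v , refl ← ∣S∣≡1⇒S≡⁅x⁆ {S = S} (suc-injective eq) =
  zero , suc v , cong (inside ∷_) (sym (∪-identityˡ ⁅ v ⁆₁))

module _ {k n} (φ : Fin k ↣ Fin n) where
  open Injection φ renaming (to to φ[_]; injective to φ-injective)

  image-⊆ : ∀ {u v u′ v′} → ⁅ u , v ⁆ ⊆ ⁅ u′ , v′ ⁆ →
            ⁅ φ[ u ] , φ[ v ] ⁆ ⊆ ⁅ φ[ u′ ] , φ[ v′ ] ⁆
  image-⊆ {u′ = u′} {v′} sub = ⁅,⁆⊆ (image (sub x∈⁅x,y⁆)) (image (sub y∈⁅x,y⁆))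
    where
    image : ∀ {w} → w ∈ ⁅ u′ , v′ ⁆ → φ[ w ] ∈ ⁅ φ[ u′ ] , φ[ v′ ] ⁆
    image w∈ with ∈⁅,⁆⁻ w∈
    ... | inj₁ refl = x∈⁅x,y⁆
    ... | inj₂ refl = y∈⁅x,y⁆

  image-⊆⁻ : ∀ {u v u′ v′} → ⁅ φ[ u ] , φ[ v ] ⁆ ⊆ ⁅ φ[ u′ ] , φ[ v′ ] ⁆ →
             ⁅ u , v ⁆ ⊆ ⁅ u′ , v′ ⁆
  image-⊆⁻ {u′ = u′} {v′} sub = ⁅,⁆⊆ (preimage (sub x∈⁅x,y⁆)) (preimage (sub y∈⁅x,y⁆))
    where
    preimage : ∀ {w} → φ[ w ] ∈ ⁅ φ[ u′ ] , φ[ v′ ] ⁆ → w ∈ ⁅ u′ , v′ ⁆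
    preimage φw∈ with ∈⁅,⁆⁻ φw∈
    ... | inj₁ eq = subst (_∈ ⁅ u′ , v′ ⁆) (sym (φ-injective eq)) x∈⁅x,y⁆
    ... | inj₂ eq = subst (_∈ ⁅ u′ , v′ ⁆) (sym (φ-injective eq)) y∈⁅x,y⁆

  -- Comparing the sets by two inclusions covers both orders of the endpoints at once. Distinct
  -- edges of `F` thus get distinct images.
  image-injective : ∀ {u v u′ v′} → ⁅ φ[ u ] , φ[ v ] ⁆ ≡ ⁅ φ[ u′ ] , φ[ v′ ] ⁆ →
                    ⁅ u , v ⁆ ≡ ⁅ u′ , v′ ⁆
  image-injective eq = ⊆-antisym
    (image-⊆⁻ λ {w} → subst (w ∈_) eq) (image-⊆⁻ λ {w} → subst (w ∈_) (sym eq))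

-- Incidence of hyperedges with the pairs inside them

module Pairs {n} (H : Hypergraph n) where

  IsPairIn : Subset n → Subset n → Set
  IsPairIn S p = ∣ p ∣ ≡ 2 × p ⊆ S

  isPairIn? : ∀ S p → Dec (IsPairIn S p)
  isPairIn? S p = (∣ p ∣ ℕ.≟ 2) ×-dec (p ⊆? S)

  pairs : Edge H → List (Subset n)
  pairs h = filter (isPairIn? (edge H h)) (subsets n)

  ∈-pairs⁻ : ∀ {p} h → p ∈ˡ pairs h → IsPairIn (edge H h) p
  ∈-pairs⁻ h p∈ = proj₂ (∈-filter⁻ (isPairIn? (edge H h)) {xs = subsets n} p∈)

  ∈-pairs⁺ : ∀ {p} h → IsPairIn (edge H h) p → p ∈ˡ pairs h
  ∈-pairs⁺ {p} h = ∈-filter⁺ (isPairIn? (edge H h)) (subsets-complete p)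

  open Matchings _≟ˢ_ pairs public

-- The red-blue graph of matched pairs

module Construction {n} (H : Hypergraph n) (κ : Pairs.König H) where
  open Pairs H
  open König κ

  used : List (Subset n)
  used = filter (uses? matching) (subsets n)

  ∈-used⁻ : ∀ {p} → p ∈ˡ used → Uses matching p
  ∈-used⁻ p∈ = proj₂ (∈-filter⁻ (uses? matching) {xs = subsets n} p∈)

  ∈-used⁺ : ∀ {p} → Uses matching p → p ∈ˡ used
  ∈-used⁺ {p} = ∈-filter⁺ (uses? matching) (subsets-complete p)

  shadow : Graph n
  shadow = record
    { hypergraph = record
      { edges  = used
      ; unique = Unique.filter⁺ (uses? matching) (subsets-unique n)
      }
    ; uniform = All.tabulate λ p∈ → let a , eq = ∈-used⁻ p∈ in
                  proj₁ (∈-pairs⁻ a (valid matching eq))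
    }

  -- The decision is an argument so that `paint-blue` and `paint-red` can match on it directly.
  paint : ∀ {p} → Dec (Reached core p) → Colour
  paint (yes _) = blue
  paint (no _)  = red

  paint-blue : ∀ {p} (d : Dec (Reached core p)) → Reached core p → paint d ≡ blue
  paint-blue (yes _) _ = refl
  paint-blue (no ¬r) r = contradiction r ¬r

  paint-red : ∀ {p} (d : Dec (Reached core p)) → ¬ Reached core p → paint d ≡ red
  paint-red (yes r) ¬r = contradiction r ¬r
  paint-red (no _)  _  = refl

  G : RedBlueGraph n
  G = record { graph = shadow ; colour = λ p → paint (reached? core p) }

  coloured⁺ : ∀ {c p} → Uses matching p → colour G p ≡ c →
              p ∈ˡ edges (hypergraph (coloured G c))
  coloured⁺ {c} u = ∈-filter⁺ (λ p → colour G p ≟ᶜ c) (∈-used⁺ u)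

  -- An edge of `F` is sent to the hyperedge matched with its image, which contains that image. A
  -- hyperedge has only one partner, so distinct edges get distinct hyperedges.
  berge : ∀ {k} (F : Graph k) → Contains F shadow → ContainsBerge F H
  berge F (φ , adj) = φ , mk↣ f-injective , λ uv _ _ → host-contains (host uv)
    where
    open Injection φ renaming (to to φ[_])

    endpoints : ∀ uv → ∃₂ λ u v → ends F uv ≡ ⁅ u , v ⁆
    endpoints uv = ∣S∣≡2⇒S≡⁅x,y⁆ (All.lookup (uniform F) (∈-lookup uv))

    Host : E F → Set
    Host uv = ∃ λ h → ∃₂ λ u v → ends F uv ≡ ⁅ u , v ⁆ ×
              match matching h ≡ just ⁅ φ[ u ] , φ[ v ] ⁆

    host : ∀ uv → Host uv
    host uv with u , v , eq ← endpoints uv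
      with h , m ← ∈-used⁻ (adj u v (subst (_∈ˡ edges (hypergraph F)) eq (∈-lookup uv))) =
      h , u , v , eq , m

    -- With hosts as variables, equality of their hyperedges can be matched with `refl`.
    host-injective : ∀ {uv uv′} (x : Host uv) (y : Host uv′) → proj₁ x ≡ proj₁ y → uv ≡ uv′
    host-injective (_ , _ , _ , e₁ , m₁) (_ , _ , _ , e₂ , m₂) refl =
      lookup-injective (unique (hypergraph F))
        (trans e₁ (trans (image-injective φ (just-injective (trans (sym m₁) m₂))) (sym e₂)))

    f : E F → Edge H
    f = proj₁ ∘ host

    f-injective : Injective _≡_ _≡_ f
    f-injective {uv} {uv′} = host-injective (host uv) (host uv′)

    -- The endpoints `u`, `v` may come in the other order than those stored in the host, so only the
    -- sets are compared.
    host-contains : ∀ {uv u v} (x : Host uv) → ends F uv ≡ ⁅ u , v ⁆ →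
                    ⁅ φ[ u ] , φ[ v ] ⁆ ⊆ edge H (proj₁ x)
    host-contains (h , _ , _ , eq′ , m) eq w∈ =
      proj₂ (∈-pairs⁻ h (valid matching m))
        (image-⊆ φ (λ {w} → subst (w ∈_) (trans (sym eq) eq′)) w∈)

  -- Any two vertices of a core hyperedge form a reached pair: `covers` makes it an edge, and being
  -- reached makes it blue.
  core-clique : ∀ {h} → h ∈ core → IsClique (coloured G blue) (edge H h)
  core-clique {h} h∈core u v u∈ v∈ u≢v =
    coloured⁺ (covers r) (paint-blue (reached? core ⁅ u , v ⁆) r)
    where
    r : Reached core ⁅ u , v ⁆
    r = h , h∈core , ∈-pairs⁺ h (∣⁅x,y⁆∣≡2 u≢v , ⁅,⁆⊆ u∈ v∈)

  -- Counting hyperedges by red edges and blue cliques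

  module _ {r : ℕ} (uni : Uniform r H) where

    isBlueK? : ∀ S → Dec (∣ S ∣ ≡ r × IsClique (coloured G blue) S)
    isBlueK? S = (∣ S ∣ ℕ.≟ r) ×-dec isClique? (coloured G blue) S

    cliques : List (Subset n)
    cliques = filter isBlueK? (subsets n)

    reds : List (Subset n)
    reds = edges (hypergraph (coloured G red))

    -- `toRed` keeps the matching equation because a red pair determines its hyperedge only through
    -- the matching; a clique is the hyperedge itself.
    data Charge (h : Edge H) : Set where
      toRed    : ∀ p → match matching h ≡ just p → p ∈ˡ reds → Charge h
      toClique : edge H h ∈ˡ cliques → Charge h

    charge : ∀ h → Charge h
    charge h with h ∈? core
    ... | yes h∈ = toClique (∈-filter⁺ isBlueK? (subsets-complete (edge H h))
                     (All.lookup uni (∈-lookup h) , core-clique h∈))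
    ... | no h∉ with p , eq , ¬r ← closed h h∉ =
      toRed p eq (coloured⁺ (h , eq) (paint-red (reached? core p) ¬r))

    slot : ∀ {h} → Charge h → Fin (e (coloured G red)) ⊎ Fin (𝒩K r (coloured G blue))
    slot (toRed _ _ p∈) = inj₁ (index p∈)
    slot (toClique h∈)  = inj₂ (index h∈)

    slot-injective : ∀ {h h′} (c : Charge h) (c′ : Charge h′) → slot c ≡ slot c′ → h ≡ h′
    slot-injective (toRed p m p∈) (toRed p′ m′ p′∈) eq
      with refl ← index-injective {xs = reds} p∈ p′∈ (inj₁-injective eq) = injective matching m m′
    slot-injective (toClique h∈) (toClique h′∈) eq =
      lookup-injective (unique H) (index-injective {xs = cliques} h∈ h′∈ (inj₂-injective eq))

    -- The charges give an injection into a disjoint union of positions; `join` encodes it as an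
    -- initial segment of length `g r G`, and `splitAt` inverts the encoding.
    size≤g : size H ≤ g r G
    size≤g = injective⇒≤ {f = join a b ∘ slot ∘ charge} λ {h} {h′} eq →
      slot-injective (charge h) (charge h′)
        (trans (sym (splitAt-join a b _)) (trans (cong (splitAt a) eq) (splitAt-join a b _)))
      where
      a = e (coloured G red)
      b = 𝒩K r (coloured G blue)

lemma2 : ∀ {k n : ℕ} (F : Graph k) (r : ℕ) → 2 ≤ r →
    (H : Hypergraph n) → Uniform r H → BergeFree F H →
    Σ[ G ∈ RedBlueGraph n ] (Free F (graph G) × size H ≤ g r G)
lemma2 F r _ H uni bergeFree = G , bergeFree ∘ berge F , size≤g uni
  where open Construction H (Pairs.könig H)
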